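{- Let $k,n$ be positive integers with $k\leqslant n$ and let $C\in\mathrm{Conf}([n]^k_<)$ be a shelling order. Then its evacuation $\epsilon_D C$ is a shelling order.
   Context: $[n]:=\{1,\ldots,n\}$; $[n]^k_<$ denotes the set of $k$-element subsets of $[n]$. $\mathrm{Conf}([n]^k_<)$ is the set of tuples $C=(C_1,\ldots,C_h)$, $h\geqslant1$, of pairwise distinct elements of $[n]^k_<$. $C$ is a shelling order if for all $i<j$ in $[h]$ there exists $z<j$ with $|C_z\cap C_j|=k-1$ and $C_i\cap C_j\subseteq C_z\cap C_j$. The dual graph $D(C)$ is the graph on $[h]$ with $\{i,j\}$ an edge iff $|C_i\cap C_j|=k-1$. For a graph $G$ on $[h]$, its track $T_G=\{v_1,\ldots,v_r\}$ is defined by $v_1=1$ and, for $i\geqslant2$, $v_i=\min\{j\in[h]: j>v_{i-1},\ \{v_{i-1},j\}\text{ an edge}\}$ if this exists, otherwise $r=i-1$. The promotion $\partial_G\in S_h$ is given by $\partial_G(i)=i-1$ for $i\notin T_G$, $\partial_G(v_j)=v_{j+1}-1$ for $j\in[r-1]$, $\partial_G(v_r)=h$. For $\sigma\in S_h$, $\sigma C:=(C_{\sigma^{ -1}(1)},\ldots,C_{\sigma^{ -1}(h)})$, and $\partial_D C:=\partial_{D(C)}C$. For $r\in[h]$, the $r$-promotion is $\partial_{r,D}C:=(\partial_D(C_1,\ldots,C_r),C_{r+1},\ldots,C_h)$, i.e. promotion applied to the prefix of length $r$ followed by the unchanged remaining entries. The evacuation is $\epsilon_D C:=(\partial_{2,D}\circ\cdots\circ\partial_{h-1,D}\circ\partial_{h,D})(C)$.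 -}

module Defs where

open import Data.Fin.Base using (Fin; zero; suc; toℕ; fromℕ; inject₁; pred; _<_; punchOut)
open import Data.Fin.Permutation using (Permutation′; permutation; _⟨$⟩ˡ_)
open import Data.Fin.Properties using
  (_≟_; _<?_; any?; toℕ-injective; inject₁-injective; fromℕ≢inject₁;
   injective⇒≤; punchOut-injective; <-irrefl)
open import Data.Fin.Subset using (Subset; ∣_∣; _∩_; _⊆_)
open import Data.List.Base using
  (List; []; _∷_; _++_; length; lookup; tabulate; take; drop; filter; head; allFin)
open import Data.List.Relation.Unary.All using (All)
open import Data.List.Relation.Unary.Unique.Propositional using (Unique)
open import Data.Maybe.Base using (Maybe; just; nothing; _>>=_; maybe′)
open import Data.Maybe.Properties using (just-injective; ≡-dec)
open import Data.Nat.Base as ℕ using (ℕ; zero; suc; _∸_)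
import Data.Nat.Properties as ℕ
open import Data.Product.Base using (_×_; _,_; ∃-syntax; proj₁; proj₂)
open import Function.Definitions using (Injective)
open import Level using (0ℓ)
open import Relation.Binary.Core using (Rel)
open import Relation.Binary.Definitions using
  (Decidable; Symmetric; Irreflexive; tri<; tri≈; tri>)
open import Relation.Binary.PropositionalEquality
open import Relation.Nullary using (¬_; Dec; yes; no; contradiction)
open import Relation.Nullary.Decidable using (_×-dec_; ¬?; map′)
import Relation.Unary as U

------------------------------------------------------------------------
-- Configurations and shelling orders

-- Tuples are lists and [n] is Fin n, so all positions are 0-based:
-- C_i of the mathematical text is lookup C (i - 1).

record IsConf {n : ℕ} (k : ℕ) (C : List (Subset n)) : Set where
  field
    nonEmpty : 1 ℕ.≤ length C
    sizes    : All (λ S → ∣ S ∣ ≡ k) C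
    distinct : Unique C

IsShellingOrder : {n : ℕ} → ℕ → List (Subset n) → Set
IsShellingOrder k C = ∀ (i j : Fin (length C)) → i < j →
  ∃[ z ] z < j
       × ∣ lookup C z ∩ lookup C j ∣ ≡ k ∸ 1
       × (lookup C i ∩ lookup C j) ⊆ (lookup C z ∩ lookup C j)

------------------------------------------------------------------------
-- Graphs on [h]

record Graph (h : ℕ) : Set₁ where
  field
    Adj    : Rel (Fin h) 0ℓ
    adj?   : Decidable Adj
    symm   : Symmetric Adj
    irrefl : Irreflexive _≡_ Adj

------------------------------------------------------------------------
-- Track and promotion of a graph

private
  head-filter : ∀ {A : Set} {P : A → Set} (P? : U.Decidable P) xs {y} →
                head (filter P? xs) ≡ just y → P y
  head-filter P? (x ∷ xs) eq with P? x
  ... | yes px = subst _ (just-injective eq) px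
  ... | no _   = head-filter P? xs eq

  injective⇒surjective : ∀ {h} (f : Fin h → Fin h) → Injective _≡_ _≡_ f →
                         ∀ y → ∃[ x ] f x ≡ y
  injective⇒surjective {suc h} f inj y with any? (λ x → f x ≟ y)
  ... | yes p = p
  ... | no ¬p = contradiction (injective⇒≤ avoid-injective) ℕ.1+n≰n
    where
    y≢f : ∀ x → y ≢ f x
    y≢f x eq = ¬p (x , sym eq)

    avoid : Fin (suc h) → Fin h
    avoid x = punchOut (y≢f x)

    avoid-injective : Injective _≡_ _≡_ avoid
    avoid-injective {a} {b} eq = inj (punchOut-injective (y≢f a) (y≢f b) eq)

module _ {m : ℕ} (G : Graph (suc m)) where
  open Graph G

  private
    Vertex : Set
    Vertex = Fin (suc m)

  -- min { j : j > v, {v , j} an edge }, if it exists; allFin is increasing.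
  next : Vertex → Maybe Vertex
  next v = head (filter (λ j → (v <? j) ×-dec adj? v j) (allFin (suc m)))

  -- track i is v_{i+1} if i < r, and nothing otherwise.
  track : ℕ → Maybe Vertex
  track zero    = just zero
  track (suc i) = track i >>= next

  InTrack : Vertex → Set
  InTrack v = ∃[ i ] track i ≡ just v

  private
    next-> : ∀ {v w} → next v ≡ just w → v < w
    next-> {v} eq =
      proj₁ (head-filter (λ j → (v <? j) ×-dec adj? v j) (allFin (suc m)) eq)

    track-pred : ∀ i {w} → track (suc i) ≡ just w →
                 ∃[ v ] (track i ≡ just v × next v ≡ just w)
    track-pred i eq with track i
    ... | just v = v , refl , eq

    track-next : ∀ i {v} → track i ≡ just v → track (suc i) ≡ next v
    track-next i eq rewrite eq = refl

    track-index : ∀ i {v} → track i ≡ just v → i ℕ.≤ toℕ v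
    track-index zero    _  = ℕ.z≤n
    track-index (suc i) eq with track-pred i eq
    ... | v , p , q = ℕ.≤-<-trans (track-index i p) (next-> q)

    track-mono′ : ∀ i d {v w} → track i ≡ just v →
                  track (suc d ℕ.+ i) ≡ just w →
                  v < w × ∃[ u ] next v ≡ just u × toℕ u ℕ.≤ toℕ w
    track-mono′ i zero    p q =
      let e = trans (sym (track-next i p)) q
      in next-> e , _ , e , ℕ.≤-refl
    track-mono′ i (suc d) p q with track-pred (suc d ℕ.+ i) q
    ... | x , tx , nx with track-mono′ i d p tx
    ... | v<x , u , nu , u≤x =
      ℕ.<-trans v<x (next-> nx) , u , nu , ℕ.≤-trans u≤x (ℕ.<⇒≤ (next-> nx))

    track-mono : ∀ i j {v w} → i ℕ.< j → track i ≡ just v → track j ≡ just w →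
                 ∃[ u ] next v ≡ just u × toℕ u ℕ.≤ toℕ w
    track-mono i j {v} {w} i<j p q =
      proj₂ (track-mono′ i (j ∸ suc i) p (trans (cong track eq) q))
      where
      eq : suc (j ∸ suc i) ℕ.+ i ≡ j
      eq = trans (sym (ℕ.+-suc (j ∸ suc i) i)) (ℕ.m∸n+n≡m i<j)

    track-next-≢ : ∀ i j {v w} → i ℕ.< j → track i ≡ just v → track j ≡ just w →
                   next v ≢ next w
    track-next-≢ i j {v} {w} i<j p q e with track-mono i j i<j p q
    ... | u , nu , u≤w = ℕ.<⇒≱ (next-> (trans (sym e) nu)) u≤w

    next-injective : ∀ {v w} → InTrack v → InTrack w → next v ≡ next w → v ≡ w
    next-injective (i , p) (j , q) e with ℕ.<-cmp i j
    ... | tri< i<j _ _ = contradiction e (track-next-≢ i j i<j p q)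
    ... | tri≈ _ refl _ = just-injective (trans (sym p) q)
    ... | tri> _ _ j<i = contradiction (sym e) (track-next-≢ j i j<i q p)

  inTrack? : ∀ v → Dec (InTrack v)
  inTrack? v = map′ (λ (i , _ , p) → i , p)
                    (λ (i , p) → i , ℕ.s≤s (track-index i p) , p)
                    (ℕ.anyUpTo? (λ i → ≡-dec _≟_ (track i) (just v)) (suc (toℕ v)))

  -- On the track, next sends v_j to v_{j+1} for j < r and is undefined at v_r.
  promote : Vertex → Vertex
  promote v with inTrack? v
  ... | no  _ = pred v
  ... | yes _ = maybe′ pred (fromℕ m) (next v)

  private
    pred-injective : ∀ {v w : Vertex} → v ≢ zero → w ≢ zero → pred v ≡ pred w → v ≡ w
    pred-injective {zero}          v≢0 _   _  = contradiction refl v≢0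
    pred-injective {suc _} {zero}  _   w≢0 _  = contradiction refl w≢0
    pred-injective {suc _} {suc _} _   _   eq = cong suc (inject₁-injective eq)

    pred≢last : ∀ {v : Vertex} → v ≢ zero → pred v ≢ fromℕ m
    pred≢last {zero}  v≢0 _  = v≢0 refl
    pred≢last {suc _} _   eq = fromℕ≢inject₁ (sym eq)

    next≢0 : ∀ {v w} → next v ≡ just w → w ≢ zero
    next≢0 eq refl = contradiction (next-> eq) ℕ.n≮0

    offTrack≢0 : ∀ {v} → ¬ InTrack v → v ≢ zero
    offTrack≢0 ¬t refl = ¬t (0 , refl)

    off≢on : ∀ {v w} → ¬ InTrack v → InTrack w →
             pred v ≢ maybe′ pred (fromℕ m) (next w)
    off≢on {v} {w} ¬t (i , p) eq with next w in nw
    ... | nothing = pred≢last (offTrack≢0 ¬t) eq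
    ... | just u with pred-injective (offTrack≢0 ¬t) (next≢0 nw) eq
    ...   | refl = ¬t (suc i , trans (track-next i p) nw)

    on-injective : ∀ {v w} → maybe′ pred (fromℕ m) (next v) ≡ maybe′ pred (fromℕ m) (next w) →
                   next v ≡ next w
    on-injective {v} {w} eq with next v in nv | next w in nw
    ... | nothing | nothing = refl
    ... | nothing | just _  = contradiction (sym eq) (pred≢last (next≢0 nw))
    ... | just _  | nothing = contradiction eq (pred≢last (next≢0 nv))
    ... | just _  | just _  = cong just (pred-injective (next≢0 nv) (next≢0 nw) eq)

  promote-injective : Injective _≡_ _≡_ promote
  promote-injective {v} {w} eq with inTrack? v | inTrack? w
  ... | no ¬s | no ¬t = pred-injective (offTrack≢0 ¬s) (offTrack≢0 ¬t) eq
  ... | no ¬s | yes t = contradiction eq (off≢on ¬s t)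
  ... | yes s | no ¬t = contradiction (sym eq) (off≢on ¬t s)
  ... | yes s | yes t = next-injective s t (on-injective eq)

  promotion : Permutation′ (suc m)
  promotion = permutation promote (λ y → proj₁ (surj y)) (λ y → proj₂ (surj y))
                (λ x → promote-injective (proj₂ (surj (promote x))))
    where surj = injective⇒surjective promote promote-injective

------------------------------------------------------------------------
-- Promotion and evacuation of tuples

module _ {n : ℕ} (k : ℕ) where

  dualGraph : (C : List (Subset n)) → Graph (length C)
  dualGraph C = record
    { Adj    = λ i j → i ≢ j × ∣ lookup C i ∩ lookup C j ∣ ≡ k ∸ 1
    ; adj?   = λ i j → ¬? (i ≟ j) ×-dec (∣ lookup C i ∩ lookup C j ∣ ℕ.≟ k ∸ 1)
    ; symm   = λ {i} {j} (i≢j , eq) →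
                 (λ j≡i → i≢j (sym j≡i)) ,
                 trans (cong ∣_∣ (∩-comm (lookup C j) (lookup C i))) eq
    ; irrefl = λ i≡j (i≢j , _) → i≢j i≡j
    }
    where open import Data.Fin.Subset.Properties using (∩-comm)

  act : (C : List (Subset n)) → Permutation′ (length C) → List (Subset n)
  act C σ = tabulate (λ i → lookup C (σ ⟨$⟩ˡ i))

  ∂ : List (Subset n) → List (Subset n)
  ∂ []        = []   -- not a configuration
  ∂ C@(_ ∷ _) = act C (promotion (dualGraph C))

  ∂[_] : ℕ → List (Subset n) → List (Subset n)
  ∂[ r ] C = ∂ (take r C) ++ drop r C

  -- ∂[ 2 ] ∘ ⋯ ∘ ∂[ r ∸ 1 ] ∘ ∂[ r ], with ∂[ r ] applied first
  evacuateFrom : ℕ → List (Subset n) → List (Subset n)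
  evacuateFrom 0             C = C
  evacuateFrom 1             C = C
  evacuateFrom (suc (suc r)) C = evacuateFrom (suc r) (∂[ suc (suc r) ] C)

  evacuation : List (Subset n) → List (Subset n)
  evacuation C = evacuateFrom (length C) C

{-# OPTIONS --safe #-}

-- An edge {b , c} of the dual graph with b < c keeps its orientation under
-- promotion: if b is on the track, its successor there is at most c, so b moves
-- to position c - 1 or earlier, while no entry moves left by more than one step.
-- Hence the entry z that a shelling order provides for a pair i < j still
-- precedes j after promotion.  The only new requirements come from pairs b < a
-- which promotion inverts.  The shelling condition for (b , a) gives z < a with
-- an edge {z , a} and C_b ∩ C_a ⊆ C_z; here z also precedes b after promotion, so
-- a can be replaced by the smaller z until it drops below b.  Thus promotion
-- preserves shelling orders, and so do the r-promotions, since the shelling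
-- condition for C_j depends only on the set of entries preceding C_j.

module Submission where

open import Defs
open import Data.Fin.Base using (Fin; zero; suc; toℕ; pred; _<_) renaming (_≤_ to _≤ᶠ_)
open import Data.Fin.Induction using (<-wellFounded; Acc; acc)
open import Data.Fin.Permutation using (Permutation′; _⟨$⟩ʳ_; _⟨$⟩ˡ_; inverseʳ; inverseˡ)
open import Data.Fin.Properties using
  (_<?_; toℕ-inject₁; ≤fromℕ; ≤∧≢⇒<; <⇒≢; <-cmp; <-irrefl)
open import Data.Fin.Subset using (Subset; ∣_∣; _∩_; _⊆_)
open import Data.Fin.Subset.Properties using (x∈p∩q⁺; x∈p∩q⁻)
open import Data.List.Base using
  (List; []; _∷_; _++_; length; lookup; tabulate; take; drop; filter; head; allFin)
open import Data.List.Membership.Propositional using (_∈_)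
open import Data.List.Membership.Propositional.Properties using (∈-allFin; ∈-tabulate⁺)
open import Data.List.Membership.Propositional.Properties.WithK using (unique∧set⇒bag)
open import Data.List.Properties using (tabulate-lookup; map-tabulate; take++drop≡id)
open import Data.List.Relation.Binary.BagAndSetEquality using (∼bag⇒↭)
open import Data.List.Relation.Binary.Permutation.Propositional using
  (_↭_; ↭-refl; ↭-reflexive; ↭-sym; ↭-trans; ↭⇒↭ₛ)
open import Data.List.Relation.Binary.Permutation.Propositional.Properties using
  (∈-resp-↭; All-resp-↭; ↭-length; map⁺; ++⁺ʳ)
open import Data.List.Relation.Binary.Permutation.Setoid.Properties using (Unique-resp-↭)
import Data.List.Relation.Unary.All as All
open import Data.List.Relation.Unary.AllPairs using (AllPairs; _∷_)
import Data.List.Relation.Unary.AllPairs.Properties as AllPairs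
open import Data.List.Relation.Unary.Any using (here; there)
open import Data.List.Relation.Unary.Unique.Propositional.Properties using (tabulate⁺; allFin⁺)
open import Data.Maybe.Base using (just; nothing)
open import Data.Nat.Base as ℕ using (ℕ; zero; suc; _≤_; _∸_; z<s; s<s; s<s⁻¹)
import Data.Nat.Properties as ℕ
open import Data.Product.Base using (_×_; _,_; ∃-syntax; proj₁; proj₂)
open import Data.Sum.Base using (inj₁; inj₂; [_,_]′)
open import Function.Base using (_∘_; id)
open import Function.Bundles using (mk⇔)
open import Level using (0ℓ)
open import Relation.Binary.Definitions using (tri<; tri≈; tri>)
open import Relation.Binary.PropositionalEquality hiding ([_])
open import Relation.Nullary using (yes; no; contradiction)
open import Relation.Nullary.Decidable using (_×-dec_)
import Relation.Unary as U
open import Relation.Unary.Properties using (≐-sym)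

-- Predecessors, permuted tabulations and filtered lists

pred-mono-≤ : ∀ {m} {i j : Fin m} → i ≤ᶠ j → pred i ≤ᶠ pred j
pred-mono-≤ {i = i} {j} i≤j = subst₂ ℕ._≤_ (sym (toℕ-pred i)) (sym (toℕ-pred j)) (ℕ.pred-mono-≤ i≤j)
  where
  toℕ-pred : ∀ {m} (i : Fin m) → toℕ (pred i) ≡ ℕ.pred (toℕ i)
  toℕ-pred zero    = refl
  toℕ-pred (suc i) = toℕ-inject₁ i

-- `f` may have repeated values, so the comparison is made on indices: the list of all `π ⟨$⟩ˡ i`
-- and `allFin` are duplicate-free with the same members, and `f` is mapped over them afterwards.
tabulate-permute : ∀ {A : Set} {m} (f : Fin m → A) (π : Permutation′ m) →
                   tabulate (λ i → f (π ⟨$⟩ˡ i)) ↭ tabulate f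
tabulate-permute f π =
  subst₂ _↭_ (map-tabulate (π ⟨$⟩ˡ_) f) (map-tabulate id f) (map⁺ f (∼bag⇒↭
    (unique∧set⇒bag (tabulate⁺ inj) (allFin⁺ _)
      (λ {i} → mk⇔ (λ _ → ∈-allFin _)
           (λ _ → subst (_∈ tabulate (π ⟨$⟩ˡ_)) (inverseˡ π) (∈-tabulate⁺ (π ⟨$⟩ʳ i)))))))
  where
  inj : ∀ {i j} → π ⟨$⟩ˡ i ≡ π ⟨$⟩ˡ j → i ≡ j
  inj eq = trans (sym (inverseʳ π)) (trans (cong (π ⟨$⟩ʳ_) eq) (inverseʳ π))

head-filter-satisfies : ∀ {A : Set} {P : A → Set} (P? : U.Decidable P) xs {y} →
                        head (filter P? xs) ≡ just y → P y
head-filter-satisfies P? (x ∷ xs) eq with P? x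
head-filter-satisfies P? (x ∷ xs) refl | yes px = px
head-filter-satisfies P? (x ∷ xs) eq   | no _   = head-filter-satisfies P? xs eq

-- This is what makes `next`, defined as the head of a filtered list, the minimum it stands for.
head-filter-least : ∀ {m} {P : Fin m → Set} (P? : U.Decidable P) {xs c} →
                    AllPairs _<_ xs → c ∈ xs → P c →
                    ∃[ u ] head (filter P? xs) ≡ just u × u ≤ᶠ c
head-filter-least P? {x ∷ xs} (x<xs ∷ sorted) c∈ pc with P? x
... | yes _ = x , refl , least c∈
  where
  least : ∀ {c} → c ∈ x ∷ xs → x ≤ᶠ c
  least (here refl)  = ℕ.≤-refl
  least (there c∈xs) = ℕ.<⇒≤ (All.lookup x<xs c∈xs)
head-filter-least P? (_ ∷ _)      (here refl)  pc | no ¬px = contradiction pc ¬px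
head-filter-least P? (_ ∷ sorted) (there c∈xs) pc | no _   = head-filter-least P? sorted c∈xs pc

-- Promotion and the orientation of edges

module _ {m : ℕ} (G : Graph (suc m)) where
  open Graph G

  next-> : ∀ {v w} → next G v ≡ just w → v < w
  next-> {v} eq = proj₁ (head-filter-satisfies (λ j → (v <? j) ×-dec adj? v j) (allFin (suc m)) eq)

  next-least : ∀ {b c} → b < c → Adj b c → ∃[ u ] next G b ≡ just u × u ≤ᶠ c
  next-least {b} {c} b<c bc =
    head-filter-least (λ j → (b <? j) ×-dec adj? b j)
      (AllPairs.tabulate⁺-< id) (∈-allFin c) (b<c , bc)

  pred≤promote : ∀ a → pred a ≤ᶠ promote G a
  pred≤promote a with inTrack? G a
  ... | no _ = ℕ.≤-refl
  ... | yes _ with next G a in eq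
  -- The end of the track is sent to the last position, which bounds everything.
  ...   | nothing = ≤fromℕ (pred a)
  ...   | just u  = pred-mono-≤ (ℕ.<⇒≤ (next-> eq))

  promote≤pred : ∀ {b c} → b < c → Adj b c → promote G b ≤ᶠ pred c
  promote≤pred {b} b<c bc with inTrack? G b
  ... | no _ = pred-mono-≤ (ℕ.<⇒≤ b<c)
  ... | yes _ with next G b | next-least b<c bc
  -- `c` is itself a candidate for the successor of `b`, so `b` does not end the track.
  ...   | just _ | _ , refl , u≤c = pred-mono-≤ u≤c

  promote-edge-< : ∀ {b c} → b < c → Adj b c → promote G b < promote G c
  promote-edge-< {b} {c} b<c bc =
    -- `pred c` separates the two images only weakly; injectivity of promotion makes the inequality
    -- strict.
    ≤∧≢⇒< (ℕ.≤-trans (promote≤pred b<c bc) (pred≤promote c))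
           (<⇒≢ b<c ∘ promote-injective G)

-- Shelling orders: sets of earlier entries and permuted positions

module _ {n : ℕ} (k : ℕ) where

  Attached : U.Pred (Subset n) 0ℓ → Subset n → Set
  Attached V x = ∀ {a} → V a →
    ∃[ z ] V z × ∣ z ∩ x ∣ ≡ k ∸ 1 × (a ∩ x) ⊆ (z ∩ x)

  Attached-resp-≐ : ∀ {V W x} → V U.≐ W → Attached V x → Attached W x
  Attached-resp-≐ (V⊆W , W⊆V) att w =
    let z , v , adj , sub = att (W⊆V w) in z , V⊆W v , adj , sub

  -- `V` holds the entries placed before the list. A list can thus be cut at `++`, with its prefix
  -- entering the condition on the rest only as a set.
  data ShellingAfter (V : U.Pred (Subset n) 0ℓ) : List (Subset n) → Set where
    []  : ShellingAfter V []
    _∷_ : ∀ {x xs} → Attached V x → ShellingAfter (V U.∪ (_≡ x)) xs → ShellingAfter V (x ∷ xs)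

  ShellingAfter-resp-≐ : ∀ {V W xs} → V U.≐ W → ShellingAfter V xs → ShellingAfter W xs
  ShellingAfter-resp-≐ _             []         = []
  ShellingAfter-resp-≐ e@(V⊆W , W⊆V) (att ∷ sh) =
    Attached-resp-≐ e att ∷
    ShellingAfter-resp-≐ ([ inj₁ ∘ V⊆W , inj₂ ]′ , [ inj₁ ∘ W⊆V , inj₂ ]′) sh

  ∪-∷ : ∀ {V : U.Pred (Subset n) 0ℓ} x xs → ((V U.∪ (_≡ x)) U.∪ (_∈ xs)) U.≐ (V U.∪ (_∈ (x ∷ xs)))
  ∪-∷ x xs = [ [ inj₁ , inj₂ ∘ here ]′ , inj₂ ∘ there ]′ ,
             λ { (inj₁ v)         → inj₁ (inj₁ v)
               ; (inj₂ (here e))  → inj₁ (inj₂ e)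
               ; (inj₂ (there p)) → inj₂ p }

  ShellingAfter-++⁻ : ∀ {V} xs {ys} → ShellingAfter V (xs ++ ys) →
                      ShellingAfter V xs × ShellingAfter (V U.∪ (_∈ xs)) ys
  ShellingAfter-++⁻ []       sh =
    [] , ShellingAfter-resp-≐ (inj₁ , [ id , (λ ()) ]′) sh
  ShellingAfter-++⁻ (x ∷ xs) (att ∷ sh) =
    let sh₁ , sh₂ = ShellingAfter-++⁻ xs sh
    in att ∷ sh₁ , ShellingAfter-resp-≐ (∪-∷ x xs) sh₂

  ShellingAfter-++⁺ : ∀ {V} xs {ys} → ShellingAfter V xs →
                      ShellingAfter (V U.∪ (_∈ xs)) ys → ShellingAfter V (xs ++ ys)
  ShellingAfter-++⁺ []       _           sh₂ =
    ShellingAfter-resp-≐ ([ id , (λ ()) ]′ , inj₁) sh₂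
  ShellingAfter-++⁺ (x ∷ xs) (att ∷ sh₁) sh₂ =
    att ∷ ShellingAfter-++⁺ xs sh₁ (ShellingAfter-resp-≐ (≐-sym (∪-∷ x xs)) sh₂)

  -- Keeping `V` next to the positions below `j` lets an induction on the list absorb its head into
  -- `V`.
  Before : ∀ {h} → U.Pred (Subset n) 0ℓ → (Fin h → Subset n) → Fin h → U.Pred (Subset n) 0ℓ
  Before V f j = V U.∪ (λ a → ∃[ i ] i < j × a ≡ f i)

  Before-zero : ∀ {V h} (f : Fin (suc h) → Subset n) → Before V f zero U.≐ V
  Before-zero f = [ id , (λ ()) ]′ , inj₁

  Before-suc : ∀ {V h} (f : Fin (suc h) → Subset n) j →
               Before V f (suc j) U.≐ Before (V U.∪ (_≡ f zero)) (f ∘ suc) j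
  Before-suc f j =
    (λ { (inj₁ v)                  → inj₁ (inj₁ v)
       ; (inj₂ (zero  , _   , eq)) → inj₁ (inj₂ eq)
       ; (inj₂ (suc i , i<j , eq)) → inj₂ (i , s<s⁻¹ i<j , eq) }) ,
    (λ { (inj₁ (inj₁ v))           → inj₁ v
       ; (inj₁ (inj₂ eq))          → inj₂ (zero , z<s , eq)
       ; (inj₂ (i , i<j , eq))     → inj₂ (suc i , s<s i<j , eq) })

  ShellingAfter-tabulate⁺ : ∀ {V h} {f : Fin h → Subset n} →
    (∀ j → Attached (Before V f j) (f j)) → ShellingAfter V (tabulate f)
  ShellingAfter-tabulate⁺ {h = zero}          att = []
  ShellingAfter-tabulate⁺ {h = suc _} {f = f} att =
    Attached-resp-≐ (Before-zero f) (att zero) ∷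
    ShellingAfter-tabulate⁺ (λ j → Attached-resp-≐ (Before-suc f j) (att (suc j)))

  ShellingAfter-lookup : ∀ {V} C → ShellingAfter V C →
    ∀ j → Attached (Before V (lookup C) j) (lookup C j)
  ShellingAfter-lookup (x ∷ xs) (att ∷ _)  zero    =
    Attached-resp-≐ (≐-sym (Before-zero (lookup (x ∷ xs)))) att
  ShellingAfter-lookup (x ∷ xs) (_   ∷ sh) (suc j) =
    Attached-resp-≐ (≐-sym (Before-suc (lookup (x ∷ xs)) j)) (ShellingAfter-lookup xs sh j)

  -- `IsShellingOrder k C` is the case `f = lookup C`. Over a fixed `Fin h`, reindexing by a
  -- permutation leaves the type of positions unchanged.
  ShellingFamily : ∀ {h} → (Fin h → Subset n) → Set
  ShellingFamily f = ∀ i j → i < j →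
    ∃[ z ] z < j × ∣ f z ∩ f j ∣ ≡ k ∸ 1 × (f i ∩ f j) ⊆ (f z ∩ f j)

  ShellingFamily⇒ShellingAfter : ∀ {h} {f : Fin h → Subset n} →
    ShellingFamily f → ShellingAfter U.∅ (tabulate f)
  ShellingFamily⇒ShellingAfter {f = f} sh = ShellingAfter-tabulate⁺
    λ { j (inj₁ ())
      ; j (inj₂ (i , i<j , refl)) →
        let z , z<j , adj , sub = sh i j i<j
        in f z , inj₂ (z , z<j , refl) , adj , sub }

  IsShellingOrder⇒ShellingAfter : ∀ {C} → IsShellingOrder k C → ShellingAfter U.∅ C
  IsShellingOrder⇒ShellingAfter {C} sh =
    subst (ShellingAfter U.∅) (tabulate-lookup C) (ShellingFamily⇒ShellingAfter sh)

  ShellingAfter⇒IsShellingOrder : ∀ {C} → ShellingAfter U.∅ C → IsShellingOrder k C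
  ShellingAfter⇒IsShellingOrder {C} sh i j i<j
    with ShellingAfter-lookup C sh j (inj₂ (i , i<j , refl))
  ... | _ , inj₂ (z , z<j , refl) , adj , sub = z , z<j , adj , sub

  -- All that is needed of promotion is that edges keep their orientation. Hence the argument works
  -- for any such permutation.
  ShellingFamily-permute : ∀ {h} (f : Fin h → Subset n) (π : Permutation′ h) →
    (∀ {a b} → a < b → ∣ f a ∩ f b ∣ ≡ k ∸ 1 → π ⟨$⟩ʳ a < π ⟨$⟩ʳ b) →
    ShellingFamily f → ShellingFamily (λ i → f (π ⟨$⟩ˡ i))
  ShellingFamily-permute f π edge-< sh i j i<j =
    let z , σz<σj , adj , sub =
          attached (π ⟨$⟩ˡ i) (π ⟨$⟩ˡ j) (<-wellFounded _)
            (subst₂ _<_ (sym (inverseʳ π)) (sym (inverseʳ π)) i<j)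
        -- `z` is an old position; the witness required is its new position `σ z`, which carries the
        -- same entry.
        z′ = sym (cong f (inverseˡ π {z}))
    in σ z , subst (σ z <_) (inverseʳ π) σz<σj ,
       subst (λ y → ∣ y ∩ f (π ⟨$⟩ˡ j) ∣ ≡ k ∸ 1) z′ adj ,
       subst (λ y → (f (π ⟨$⟩ˡ i) ∩ f (π ⟨$⟩ˡ j)) ⊆ (y ∩ f (π ⟨$⟩ˡ j))) z′ sub
    where
    σ = π ⟨$⟩ʳ_

    attached : ∀ a b → Acc _<_ a → σ a < σ b →
      ∃[ z ] σ z < σ b × ∣ f z ∩ f b ∣ ≡ k ∸ 1 × (f a ∩ f b) ⊆ (f z ∩ f b)
    attached a b (acc rs) σa<σb with <-cmp a b
    ... | tri< a<b _ _ =
      let z , z<b , adj , sub = sh a b a<b in z , edge-< z<b adj , adj , sub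
    ... | tri≈ _ refl _ = contradiction σa<σb (<-irrefl refl)
    ... | tri> _ _ b<a =
      -- The pair is inverted, so the shelling condition is used with `a` as the later entry.
      let z , z<a , adj , sub = sh b a b<a
          w , σw<σb , adj′ , sub′ =
            -- The edge from `z` to `a` keeps its orientation, so `σ z < σ a < σ b` and `z` can take
            -- the place of `a`.
            attached z b (rs z<a) (ℕ.<-trans (edge-< z<a adj) σa<σb)
      -- The inclusions chain as `f a ∩ f b ⊆ f z ∩ f b ⊆ f w ∩ f b`.
      in w , σw<σb , adj′ , λ v∈ →
           let v∈a , v∈b = x∈p∩q⁻ (f a) (f b) v∈
               v∈z , _   = x∈p∩q⁻ (f z) (f a) (sub (x∈p∩q⁺ (v∈b , v∈a)))
           in sub′ (x∈p∩q⁺ (v∈z , v∈b))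

  -- Promotion, prefix promotion and evacuation of lists

  ∂-shelling : ∀ (C : List (Subset n)) → ShellingAfter U.∅ C → ShellingAfter U.∅ (∂ k C)
  ∂-shelling []        _  = []
  ∂-shelling C@(_ ∷ _) sh = ShellingFamily⇒ShellingAfter
    (ShellingFamily-permute (lookup C) (promotion (dualGraph k C))
      (λ a<b adj → promote-edge-< (dualGraph k C) a<b (<⇒≢ a<b , adj))
      (ShellingAfter⇒IsShellingOrder sh))

  -- Serves two purposes: the entries after a promoted prefix still see the same set before them,
  -- and evacuation yields a configuration again.
  ∂-↭ : ∀ (C : List (Subset n)) → ∂ k C ↭ C
  ∂-↭ []        = ↭-refl
  ∂-↭ C@(_ ∷ _) = ↭-trans (tabulate-permute (lookup C) (promotion (dualGraph k C)))
                           (↭-reflexive (tabulate-lookup C))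

  ∂[]-↭ : ∀ r (C : List (Subset n)) → ∂[_] k r C ↭ C
  ∂[]-↭ r C = ↭-trans (++⁺ʳ (drop r C) (∂-↭ (take r C))) (↭-reflexive (take++drop≡id r C))

  ∂[]-shelling : ∀ r (C : List (Subset n)) → ShellingAfter U.∅ C → ShellingAfter U.∅ (∂[_] k r C)
  ∂[]-shelling r C sh =
    let sh₁ , sh₂ = ShellingAfter-++⁻ (take r C)
                      (subst (ShellingAfter U.∅) (sym (take++drop≡id r C)) sh)
        perm = ∂-↭ (take r C)
    in ShellingAfter-++⁺ (∂ k (take r C)) (∂-shelling (take r C) sh₁)
         -- The untouched tail was attached to the old prefix; the promoted prefix has the same
         -- members.
         (ShellingAfter-resp-≐
           ( [ inj₁ , inj₂ ∘ ∈-resp-↭ (↭-sym perm) ]′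
           , [ inj₁ , inj₂ ∘ ∈-resp-↭ perm ]′ ) sh₂)

  evacuateFrom-↭ : ∀ r (C : List (Subset n)) → evacuateFrom k r C ↭ C
  evacuateFrom-↭ 0             C = ↭-refl
  evacuateFrom-↭ 1             C = ↭-refl
  evacuateFrom-↭ (suc (suc r)) C =
    ↭-trans (evacuateFrom-↭ (suc r) (∂[_] k (suc (suc r)) C)) (∂[]-↭ (suc (suc r)) C)

  evacuateFrom-shelling : ∀ r (C : List (Subset n)) →
    ShellingAfter U.∅ C → ShellingAfter U.∅ (evacuateFrom k r C)
  evacuateFrom-shelling 0             C sh = sh
  evacuateFrom-shelling 1             C sh = sh
  evacuateFrom-shelling (suc (suc r)) C sh =
    evacuateFrom-shelling (suc r) _ (∂[]-shelling (suc (suc r)) C sh)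

  IsConf-resp-↭ : ∀ {C D : List (Subset n)} → C ↭ D → IsConf k C → IsConf k D
  IsConf-resp-↭ C↭D conf = record
    { nonEmpty = subst (1 ≤_) (↭-length C↭D) nonEmpty
    ; sizes    = All-resp-↭ C↭D sizes
    ; distinct = Unique-resp-↭ (setoid (Subset n)) (↭⇒↭ₛ C↭D) distinct
    }
    where open IsConf conf

theorem5p11 : ∀ (k n : ℕ) → 1 ≤ k → 1 ≤ n → k ≤ n →
    (C : List (Subset n)) → IsConf k C → IsShellingOrder k C →
    IsConf k (evacuation k C) × IsShellingOrder k (evacuation k C)
theorem5p11 k n _ _ _ C conf sh =
  IsConf-resp-↭ k (↭-sym (evacuateFrom-↭ k (length C) C)) conf ,
  ShellingAfter⇒IsShellingOrder k
    (evacuateFrom-shelling k (length C) C (IsShellingOrder⇒ShellingAfter k sh))
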